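{- Let $\mathbf{var}$ be a countably infinite set. Every conjunctive table algebra (with equality) is a projectional semilattice. That is, for every set $G$, if $A \subseteq \mathrm{Tab}(G)$ is the universe of a subalgebra of $\mathbf{Tab}(G)$, then $(A,\Join,\emptyset,\{\langle\rangle\},\mathrm{del}_x,E_{xy},\mathrm{schema})_{x,y\in\mathbf{var}}$ satisfies all the projectional semilattice axioms (PS0)–(PS12), with $\Join$ in the role of $\wedge$, $\emptyset$ in the role of $0$, $\{\langle\rangle\}$ in the role of $1$, $\mathrm{del}_x$ in the role of $c_x$, $E_{xy}$ in the role of $d_{xy}$, and $\mathrm{schema}$ in the role of $\mathrm{dom}$.
   Context: **Tables.** Let $G$ be a set. $\mathfrak{P}_{\mathrm{fin}}(\mathbf{var})$ is the set of finite subsets of $\mathbf{var}$. A table over $G$ is a set $T\subseteq G^X$ of functions $X\to G$, for some $X\in\mathfrak{P}_{\mathrm{fin}}(\mathbf{var})$; $\mathrm{Tab}(G)=\bigcup\{\mathfrak{P}(G^X)\mid X\in\mathfrak{P}_{\mathrm{fin}}(\mathbf{var})\}$ is the set of all tables over $G$ (there is a single empty table $\emptyset$). The function $\mathrm{schema}:\mathrm{Tab}(G)\to\mathfrak{P}(\mathbf{var})$ is given by $\mathrm{schema}(T)=X$ if $\emptyset\neq T\subseteq G^X$, and $\mathrm{schema}(\emptyset)=\mathbf{var}$. $\langle\rangle$ is the unique element of $G^{\emptyset}$ (the empty tuple). - Natural join: for nonempty $T_1\subseteq G^{X_1}$, $T_2\subseteq G^{X_2}$, $T_1\Join T_2=\{t\in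 G^{X_1\cup X_2}\mid t|_{X_1}\in T_1 \text{ and } t|_{X_2}\in T_2\}$; and $\emptyset\Join T=T\Join\emptyset=\emptyset$. - Deletion: for $T\subseteq G^X$, $\mathrm{del}_x(T)=\{t|_{X\setminus\{x\}}\mid t\in T\}$ (so $\mathrm{del}_x(\emptyset)=\emptyset$). - Equality tables: $E_{xy}=\{t\in G^{\{x,y\}}\mid t(x)=t(y)\}$ for $x,y\in\mathbf{var}$ (possibly $x=y$). $\mathbf{Tab}(G)=(\mathrm{Tab}(G),\Join,\emptyset,\{\langle\rangle\},\mathrm{del}_x,E_{xy},\mathrm{schema})_{x,y\in\mathbf{var}}$. A conjunctive table algebra (with equality) with base $G$ is a subalgebra of $\mathbf{Tab}(G)$, i.e. a subset $A\subseteq\mathrm{Tab}(G)$ containing $\emptyset$, $\{\langle\rangle\}$ and all $E_{xy}$, closed under $\Join$ and all $\mathrm{del}_x$, equipped with the restricted operations. **Projectional semilattice.** An algebra $(V,\wedge,0,1,c_x,d_{xy},\mathrm{dom})_{x,y\in\mathbf{var}}$ with a binary operation $\wedge$ on $V$, elements $0,1\in V$, functions $c_x:V\to V$ ($x\in\mathbf{var}$), elements $d_{xy}\in V$ ($x,y\in\mathbf{var}$), and a function $\mathrm{dom}:V\to\mathfrak{P}(\mathbf{var})$, such that for all $u,v\in V$ and $x,y,z\in\mathbf{var}$ (where $u\le v$ means $u=u\wedge v$): - (PS0) $(V,\wedge,0,1)$ is a bounded semilattice ($\wedge$ is associative, commutative and idempotent, with least element $0$ and greatest element $1$) - (PS1)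 $c_x(0)=0$ - (PS2) $u\le c_x(u)$ - (PS3) $c_x(u\wedge c_x(v))=c_x(u)\wedge c_x(v)$ - (PS4) $c_x(c_y(u))=c_y(c_x(u))$ - (PS5) $u\neq 0\Rightarrow(u\neq c_x(u)\Leftrightarrow u\le d_{xx})$ - (PS6) if $x\neq y$ and $x\neq z$, then $d_{yz}=c_x(d_{yx}\wedge d_{xz})$ - (PS7) $x\neq y\Rightarrow d_{xy}\wedge c_x(d_{xy}\wedge u)\le u$ - (PS8) $u\neq0\Rightarrow\mathrm{dom}(u)$ is finite - (PS9) $\mathrm{dom}(u)=\{x\in\mathbf{var}\mid u\le d_{xx}\}$ - (PS10) $\mathrm{dom}(u)=\emptyset\Rightarrow u=1$ - (PS11) $d_{xx}\neq0$ - (PS12) $d_{xy}=d_{yx}$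
   Formalization: The set G is assumed nonempty; for G = ∅ every equality table E_xx is the empty table, so axiom (PS11) fails and the claim as printed is false. -}

module Defs where

open import Algebra.Core using (Op₁; Op₂)
open import Algebra.Lattice.Structures using (IsSemilattice)
open import Data.Bool.Base using (if_then_else_; true; false)
open import Data.Empty using (⊥; ⊥-elim)
open import Data.List.Base using (List; []; _∷_; _++_; filter)
open import Data.List.Membership.Propositional using (_∈_)
import Data.List.Membership.DecPropositional as DecMembership
open import Data.List.Membership.Propositional.Properties using (∈-filter⁻)
open import Data.Maybe using (Maybe; nothing; Is-just)
open import Data.Nat.Base using (ℕ)
import Data.Nat.Properties as ℕ
open import Data.Product.Base using (_×_; _,_; proj₁; proj₂; ∃; ∃-syntax)
open import Data.Sum.Base using (_⊎_)
open import Function.Base using (_on_)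
open import Function.Bundles using (_⇔_; _⤖_; Bijection)
open import Level using (Level; _⊔_; suc; Lift)
open import Relation.Binary.Core using (Rel)
open import Relation.Binary.Definitions
  using (DecidableEquality; Minimum; Maximum; _Respects_)
import Relation.Binary.Construct.NaturalOrder.Left as NaturalOrder
open import Relation.Binary.PropositionalEquality
  using (_≡_; _≢_; _≗_; refl; sym; trans; subst)
open import Relation.Nullary.Decidable.Core using (does; yes; no; ¬?)
open import Relation.Nullary.Decidable using (via-injection)
open import Relation.Nullary.Negation.Core using (¬_)
open import Relation.Unary using (Pred; Empty; Satisfiable; _⊆_; _≐_)

private
  variable
    a g ℓ₁ ℓ₂ ℓ₃ p : Level
    Var : Set

-- A subset is finite when some list enumerates it (repetitions allowed).
Finite : {X : Set a} → Pred X p → Set (a ⊔ p)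
Finite {X = X} P = ∃[ xs ] P ≐ (λ (x : X) → x ∈ xs)

record RawProjectionalSemilattice (Var : Set) (ℓ₁ ℓ₂ ℓ₃ : Level)
       : Set (suc (ℓ₁ ⊔ ℓ₂ ⊔ ℓ₃)) where
  infix  4 _≈_
  infixr 7 _∧_
  field
    Carrier : Set ℓ₁
    _≈_     : Rel Carrier ℓ₂
    _∧_     : Op₂ Carrier
    𝟘 𝟙     : Carrier
    c       : Var → Op₁ Carrier
    d       : Var → Var → Carrier
    dom     : Carrier → Pred Var ℓ₃

  -- u ≤ v  is  u ≈ u ∧ v.
  open NaturalOrder _≈_ _∧_ public using (_≤_)

record IsProjectionalSemilattice {Var : Set}
       (V : RawProjectionalSemilattice Var ℓ₁ ℓ₂ ℓ₃) : Set (ℓ₁ ⊔ ℓ₂ ⊔ ℓ₃) where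
  open RawProjectionalSemilattice V
  field
    -- Elements are compared by _≈_, so the operations must respect it
    -- (for _∧_ this is part of IsSemilattice).
    c-cong   : ∀ x {u v} → u ≈ v → c x u ≈ c x v
    dom-cong : ∀ {u v} → u ≈ v → dom u ≐ dom v

    ps0-semilattice : IsSemilattice _≈_ _∧_
    ps0-least       : Minimum _≤_ 𝟘
    ps0-greatest    : Maximum _≤_ 𝟙
    ps1  : ∀ x → c x 𝟘 ≈ 𝟘
    ps2  : ∀ x u → u ≤ c x u
    ps3  : ∀ x u v → c x (u ∧ c x v) ≈ c x u ∧ c x v
    ps4  : ∀ x y u → c x (c y u) ≈ c y (c x u)
    ps5  : ∀ x u → ¬ (u ≈ 𝟘) → (¬ (u ≈ c x u)) ⇔ (u ≤ d x x)
    ps6  : ∀ x y z → x ≢ y → x ≢ z → d y z ≈ c x (d y x ∧ d x z)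
    ps7  : ∀ x y u → x ≢ y → d x y ∧ c x (d x y ∧ u) ≤ u
    ps8  : ∀ u → ¬ (u ≈ 𝟘) → Finite (dom u)
    ps9  : ∀ u → dom u ≐ (λ x → u ≤ d x x)
    ps10 : ∀ u → Empty (dom u) → u ≈ 𝟙
    ps11 : ∀ x → ¬ (d x x ≈ 𝟘)
    ps12 : ∀ x y → d x y ≈ d y x

-- Being a subset of a setoid, the universe of a subalgebra respects _≈_.
record IsSubuniverse {Var : Set} (V : RawProjectionalSemilattice Var ℓ₁ ℓ₂ ℓ₃)
       (A : Pred (RawProjectionalSemilattice.Carrier V) p)
       : Set (ℓ₁ ⊔ ℓ₂ ⊔ p) where
  open RawProjectionalSemilattice V
  field
    resp     : A Respects _≈_
    ∧-closed : ∀ {u v} → A u → A v → A (u ∧ v)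
    𝟘-closed : A 𝟘
    𝟙-closed : A 𝟙
    c-closed : ∀ x {u} → A u → A (c x u)
    d-closed : ∀ x y → A (d x y)

subalgebra : (V : RawProjectionalSemilattice Var ℓ₁ ℓ₂ ℓ₃)
             (A : Pred (RawProjectionalSemilattice.Carrier V) p) →
             IsSubuniverse V A → RawProjectionalSemilattice Var (ℓ₁ ⊔ p) ℓ₂ ℓ₃
subalgebra V A sub = record
  { Carrier = ∃ A
  ; _≈_     = V._≈_ on proj₁
  ; _∧_     = λ (u , u∈A) (v , v∈A) → u V.∧ v , ∧-closed u∈A v∈A
  ; 𝟘       = V.𝟘 , 𝟘-closed
  ; 𝟙       = V.𝟙 , 𝟙-closed
  ; c       = λ x (u , u∈A) → V.c x u , c-closed x u∈A
  ; d       = λ x y → V.d x y , d-closed x y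
  ; dom     = λ (u , _) → V.dom u
  }
  where
  module V = RawProjectionalSemilattice V
  open IsSubuniverse sub

module Tables {Var : Set} (countable : Var ⤖ ℕ) (G : Set g) where

  _≟_ : DecidableEquality Var
  _≟_ = via-injection (Bijection.injection countable) ℕ._≟_

  open DecMembership _≟_ using (_∈?_)

  -- A list of variables stands for the finite set of its members.  A function
  -- X → G with X finite is a partial function on Var whose domain is X, so
  -- that tuples over different X can be compared directly (by _≗_).
  Tuple : Set g
  Tuple = Var → Maybe G

  Dom : Tuple → Pred Var g
  Dom t x = Is-just (t x)

  G^_ : List Var → Pred Tuple g
  (G^ X) t = Dom t ≐ (_∈ X)

  ⟨⟩ : Tuple
  ⟨⟩ _ = nothing

  infixl 8 _↾_
  _↾_ : Tuple → List Var → Tuple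
  (t ↾ X) x = if does (x ∈? X) then t x else nothing

  infixl 6 _∖_
  _∖_ : List Var → Var → List Var
  X ∖ x = filter (λ y → ¬? (y ≟ x)) X

  ↾-cong : ∀ X {s t} → s ≗ t → s ↾ X ≗ t ↾ X
  ↾-cong X s≗t x with does (x ∈? X)
  ... | true  = s≗t x
  ... | false = refl

  G^-resp : ∀ X → (G^ X) Respects _≗_
  G^-resp X s≗t (⊆X , ⊇X) =
    (λ {x} j → ⊆X (subst Is-just (sym (s≗t x)) j)) ,
    (λ {x} x∈X → subst Is-just (s≗t x) (⊇X x∈X))

  ↾-G^ : ∀ X Y {t} → (∀ {x} → x ∈ Y → x ∈ X) → (G^ X) t → (G^ Y) (t ↾ Y)
  ↾-G^ X Y {t} Y⊆X (_ , ⊇X) = to , from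
    where
    to : Dom (t ↾ Y) ⊆ (_∈ Y)
    to {x} j with x ∈? Y
    ... | yes x∈Y = x∈Y
    ... | no  _   with () ← j
    from : (_∈ Y) ⊆ Dom (t ↾ Y)
    from {x} x∈Y with x ∈? Y
    ... | yes _   = ⊇X (Y⊆X x∈Y)
    ... | no  x∉Y = ⊥-elim (x∉Y x∈Y)

  -- The field frame witnesses that rows ⊆ G^X for some finite X.  It is
  -- determined (as a set) by the rows unless there are none, and it is ignored
  -- by equality of tables, so that there is a single empty table.
  record Table : Set (suc g) where
    field
      frame     : List Var
      rows      : Pred Tuple g
      rows-resp : rows Respects _≗_
      rows⊆G^   : rows ⊆ (G^ frame)
  open Table public

  infix 4 _≈_
  _≈_ : Rel Table g
  T ≈ S = rows T ≐ rows S

  ∅ : Table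
  ∅ = record
    { frame     = []
    ; rows      = λ _ → Lift g ⊥
    ; rows-resp = λ _ ()
    ; rows⊆G^   = λ ()
    }

  [⟨⟩] : Table
  [⟨⟩] = record
    { frame     = []
    ; rows      = λ t → t ≗ ⟨⟩
    ; rows-resp = λ s≗t s≗⟨⟩ x → trans (sym (s≗t x)) (s≗⟨⟩ x)
    ; rows⊆G^   = λ t≗⟨⟩ → G^-resp [] (λ x → sym (t≗⟨⟩ x)) ((λ ()) , λ ())
    }

  -- If T or S is empty then so is T ⋈ S, whatever the frames.
  infixr 7 _⋈_
  _⋈_ : Op₂ Table
  T ⋈ S = record
    { frame     = frame T ++ frame S
    ; rows      = λ t → (G^ (frame T ++ frame S)) t
                      × rows T (t ↾ frame T) × rows S (t ↾ frame S)
    ; rows-resp = λ s≗t (s∈G^ , s∈T , s∈S) →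
        G^-resp (frame T ++ frame S) s≗t s∈G^ ,
        rows-resp T (↾-cong (frame T) s≗t) s∈T ,
        rows-resp S (↾-cong (frame S) s≗t) s∈S
    ; rows⊆G^   = proj₁
    }

  del : Var → Op₁ Table
  del x T = record
    { frame     = frame T ∖ x
    ; rows      = λ t → ∃[ s ] rows T s × t ≗ s ↾ (frame T ∖ x)
    ; rows-resp = λ t≗t′ (s , s∈T , t≗s) →
        s , s∈T , λ y → trans (sym (t≗t′ y)) (t≗s y)
    ; rows⊆G^   = λ (s , s∈T , t≗s) →
        G^-resp (frame T ∖ x) (λ y → sym (t≗s y))
          (↾-G^ (frame T) (frame T ∖ x)
            (λ y∈ → proj₁ (∈-filter⁻ (λ y → ¬? (y ≟ x)) y∈)) (rows⊆G^ T s∈T))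
    }

  E : Var → Var → Table
  E x y = record
    { frame     = x ∷ y ∷ []
    ; rows      = λ t → (G^ (x ∷ y ∷ [])) t × t x ≡ t y
    ; rows-resp = λ s≗t (s∈G^ , sx≡sy) →
        G^-resp (x ∷ y ∷ []) s≗t s∈G^ ,
        trans (sym (s≗t x)) (trans sx≡sy (s≗t y))
    ; rows⊆G^   = proj₁
    }

  -- The frame if there are rows, all of Var if there are none.
  schema : Table → Pred Var g
  schema T x = (Satisfiable (rows T) × x ∈ frame T) ⊎ Empty (rows T)

  Tab : RawProjectionalSemilattice Var (suc g) g g
  Tab = record
    { Carrier = Table
    ; _≈_     = _≈_
    ; _∧_     = _⋈_
    ; 𝟘       = ∅
    ; 𝟙       = [⟨⟩]
    ; c       = del
    ; d       = E
    ; dom     = schema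
    }

open Tables public using (Tab)

{-# OPTIONS --safe #-}

-- Let a total assignment t satisfy a table T when its restriction to the frame
-- of T is a row of T.  Two tables are equal exactly when the same assignments
-- satisfy them.  Under this reading ⋈ is intersection, del x is
-- cylindrification along x, and E x y is the diagonal {t | t x = t y} together
-- with the requirement that t x be defined, so each axiom becomes a statement
-- about sets of assignments, with witnesses obtained by changing an assignment
-- at a single variable.

module Submission where

open import Defs
open import Algebra.Structures using (IsCommutativeBand)
open import Axiom.ExcludedMiddle using (ExcludedMiddle)
open import Data.Empty using (⊥-elim)
open import Data.List.Base using ([]; _∷_; _++_)
open import Data.List.Membership.Propositional using (_∈_)
import Data.List.Membership.DecPropositional as DecMembership
open import Data.List.Membership.Propositional.Properties
  using (∈-filter⁺; ∈-filter⁻; ∈-++⁺ˡ; ∈-++⁺ʳ; ∈-++⁻)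
open import Data.List.Relation.Unary.Any using (here; there)
open import Data.Maybe.Base using (Maybe; just; nothing)
open import Data.Maybe using (Is-just)
open import Data.Maybe.Relation.Unary.Any using (just)
open import Data.Nat.Base using (ℕ)
open import Data.Product.Base using (_×_; _,_; proj₁; proj₂; ∃-syntax)
open import Data.Sum.Base using (inj₁; inj₂; [_,_]′)
open import Data.Unit.Base using (tt)
open import Function.Base using (_∘_)
open import Function.Bundles using (_⤖_; Bijection; mk⇔)
open import Level using (Level; lower)
open import Relation.Binary.PropositionalEquality
  using (_≡_; _≢_; _≗_; refl; sym; trans; subst)
open import Relation.Nullary.Decidable.Core using (yes; no; ¬?; decidable-stable)
open import Relation.Nullary.Negation.Core using (¬_)
open import Relation.Unary using (Pred; Empty; Satisfiable; _⊆_; _≐_; _∩_)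
open import Relation.Unary.Properties using (≐-refl; ≐-sym; ≐-trans)

private
  variable
    g ℓ₁ ℓ₂ ℓ₃ p : Level
    Var : Set

-- Passage to subalgebras.

-- All axioms are universal over elements, and equality, operations and `dom` of the subalgebra are
-- computed on first components, so each axiom restricts.
subalgebra-isProjectionalSemilattice :
  (V : RawProjectionalSemilattice Var ℓ₁ ℓ₂ ℓ₃)
  (A : Pred (RawProjectionalSemilattice.Carrier V) p) (sub : IsSubuniverse V A) →
  IsProjectionalSemilattice V → IsProjectionalSemilattice (subalgebra V A sub)
subalgebra-isProjectionalSemilattice V A sub V-isPS = record
  { c-cong   = λ x → c-cong x
  ; dom-cong = dom-cong
  ; ps0-semilattice = record
    { isBand = record
      { isSemigroup = record
        { isMagma = record
          { isEquivalence = record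
            { refl = ∧.refl ; sym = ∧.sym ; trans = ∧.trans }
          ; ∙-cong = ∧.∙-cong
          }
        ; assoc = λ (u , _) (v , _) (w , _) → ∧.assoc u v w
        }
      ; idem = λ (u , _) → ∧.idem u
      }
    ; comm = λ (u , _) (v , _) → ∧.comm u v
    }
  ; ps0-least    = λ (u , _) → ps0-least u
  ; ps0-greatest = λ (u , _) → ps0-greatest u
  ; ps1  = ps1
  ; ps2  = λ x (u , _) → ps2 x u
  ; ps3  = λ x (u , _) (v , _) → ps3 x u v
  ; ps4  = λ x y (u , _) → ps4 x y u
  ; ps5  = λ x (u , _) → ps5 x u
  ; ps6  = ps6
  ; ps7  = λ x y (u , _) → ps7 x y u
  ; ps8  = λ (u , _) → ps8 u
  ; ps9  = λ (u , _) → ps9 u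
  ; ps10 = λ (u , _) → ps10 u
  ; ps11 = ps11
  ; ps12 = ps12
  }
  where
  open IsProjectionalSemilattice V-isPS
  module ∧ = IsCommutativeBand ps0-semilattice

module _ {Var : Set} (countable : Var ⤖ ℕ) (G : Set g) where

  open Tables countable G hiding (Tab)
  open DecMembership _≟_ using (_∈?_)
  open RawProjectionalSemilattice (Tab countable G) using (_≤_)

  private
    variable
      s t : Tuple
      P Q P₁ Q₁ : Pred Tuple g

  -- Restriction, deletion from frames, and update of tuples at one variable.

  ↾-∈ : ∀ X t {x} → x ∈ X → (t ↾ X) x ≡ t x
  ↾-∈ X t {x} x∈X with x ∈? X
  ... | yes _   = refl
  ... | no  x∉X = ⊥-elim (x∉X x∈X)

  ↾-local : ∀ X → (∀ {x} → x ∈ X → s x ≡ t x) → s ↾ X ≗ t ↾ X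
  ↾-local X s≡t x with x ∈? X
  ... | yes x∈X = s≡t x∈X
  ... | no  _   = refl

  ↾-↾ : ∀ X Y t → (∀ {x} → x ∈ Y → x ∈ X) → t ↾ X ↾ Y ≗ t ↾ Y
  ↾-↾ X Y t Y⊆X = ↾-local Y λ y∈Y → ↾-∈ X t (Y⊆X y∈Y)

  Dom-↾ : ∀ X t → Dom (t ↾ X) ⊆ (_∈ X)
  Dom-↾ X t {x} j with x ∈? X
  ... | yes x∈X = x∈X
  ... | no  _   with () ← j

  ↾∈G^ : ∀ X t → (_∈ X) ⊆ Dom t → (G^ X) (t ↾ X)
  ↾∈G^ X t X⊆ = Dom-↾ X t , λ x∈X → subst Is-just (sym (↾-∈ X t x∈X)) (X⊆ x∈X)

  ↾-total : ∀ X t → Dom t ⊆ (_∈ X) → t ↾ X ≗ t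
  ↾-total X t ⊆X x with x ∈? X
  ... | yes _   = refl
  ... | no  x∉X with t x in eq
  ...   | nothing = refl
  ...   | just _  = ⊥-elim (x∉X (⊆X (subst Is-just (sym eq) (just tt))))

  ∖-⊆ : ∀ X x {y} → y ∈ X ∖ x → y ∈ X
  ∖-⊆ X x y∈ = proj₁ (∈-filter⁻ (λ y → ¬? (y ≟ x)) y∈)

  ∖-≢ : ∀ X x {y} → y ∈ X ∖ x → y ≢ x
  ∖-≢ X x y∈ = proj₂ (∈-filter⁻ (λ y → ¬? (y ≟ x)) {xs = X} y∈)

  ∖-∈ : ∀ X x {y} → y ∈ X → y ≢ x → y ∈ X ∖ x
  ∖-∈ X x = ∈-filter⁺ (λ y → ¬? (y ≟ x))

  _[_≔_] : Tuple → Var → Maybe G → Tuple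
  (t [ x ≔ m ]) y with y ≟ x
  ... | yes _ = m
  ... | no  _ = t y

  ≔-same : ∀ t x m → (t [ x ≔ m ]) x ≡ m
  ≔-same t x m with x ≟ x
  ... | yes _   = refl
  ... | no  x≢x = ⊥-elim (x≢x refl)

  ≔-other : ∀ t x m {y} → y ≢ x → (t [ x ≔ m ]) y ≡ t y
  ≔-other t x m {y} y≢x with y ≟ x
  ... | yes y≡x = ⊥-elim (y≢x y≡x)
  ... | no  _   = refl

  -- Satisfaction of tables by assignments.

  ⟦_⟧ : Table → Pred Tuple g
  ⟦ T ⟧ t = rows T (t ↾ frame T)

  ⟦⟧-local : ∀ T {s t} → (∀ {x} → x ∈ frame T → s x ≡ t x) → ⟦ T ⟧ s → ⟦ T ⟧ t
  ⟦⟧-local T s≡t = rows-resp T (↾-local (frame T) s≡t)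

  frame-defined : ∀ T {t} → ⟦ T ⟧ t → (_∈ frame T) ⊆ Dom t
  frame-defined T {t} t⊨T x∈F =
    subst Is-just (↾-∈ (frame T) t x∈F) (proj₂ (rows⊆G^ T t⊨T) x∈F)

  rows⇒⟦⟧ : ∀ T → rows T ⊆ ⟦ T ⟧
  rows⇒⟦⟧ T {t} t∈T =
    rows-resp T (λ x → sym (↾-total (frame T) t (proj₁ (rows⊆G^ T t∈T)) x)) t∈T

  ⟦⟧⇒rows : ∀ T {t} → Dom t ⊆ (_∈ frame T) → ⟦ T ⟧ t → rows T t
  ⟦⟧⇒rows T {t} ⊆F = rows-resp T (↾-total (frame T) t ⊆F)

  -- A row `t` of `T` satisfies `S`; to be a row of `S` it must not be defined beyond `frame S`. But
  -- `t ↾ frame S` also satisfies `S`, hence `T`, so it is defined on all of `frame T`, which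
  -- therefore lies inside `frame S`.
  ⟦⟧-reflects : ∀ T S → ⟦ T ⟧ ≐ ⟦ S ⟧ → rows T ⊆ rows S
  ⟦⟧-reflects T S (T⊆S , S⊆T) {t} t∈T = ⟦⟧⇒rows S Dom⊆ t⊨S
    where
    t⊨S : ⟦ S ⟧ t
    t⊨S = T⊆S (rows⇒⟦⟧ T t∈T)
    Dom⊆ : Dom t ⊆ (_∈ frame S)
    Dom⊆ j = Dom-↾ (frame S) t
      (frame-defined T (S⊆T (rows⇒⟦⟧ S t⊨S)) (proj₁ (rows⊆G^ T t∈T) j))

  -- Equality ignores frames, but `t ↾ frame T` is a row of both tables, so its domain is both
  -- frames at once. Hence the frames have the same members and the two restrictions coincide.
  ⟦⟧-preserves : ∀ T S → T ≈ S → ⟦ T ⟧ ⊆ ⟦ S ⟧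
  ⟦⟧-preserves T S (T⊆S , _) {t} t⊨T = rows-resp S ↾≗↾ row
    where
    row : rows S (t ↾ frame T)
    row = T⊆S t⊨T
    ↾≗↾ : t ↾ frame T ≗ t ↾ frame S
    ↾≗↾ x with x ∈? frame T | x ∈? frame S
    ... | yes _   | yes _   = refl
    ... | no  _   | no  _   = refl
    ... | yes x∈T | no  x∉S =
      ⊥-elim (x∉S (proj₁ (rows⊆G^ S row) (proj₂ (rows⊆G^ T t⊨T) x∈T)))
    ... | no  x∉T | yes x∈S =
      ⊥-elim (x∉T (Dom-↾ (frame T) t (proj₂ (rows⊆G^ S row) x∈S)))

  ≐⇒≈ : ∀ T S → ⟦ T ⟧ ≐ ⟦ S ⟧ → T ≈ S
  ≐⇒≈ T S T≐S = ⟦⟧-reflects T S T≐S , ⟦⟧-reflects S T (≐-sym T≐S)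

  ≈⇒≐ : ∀ T S → T ≈ S → ⟦ T ⟧ ≐ ⟦ S ⟧
  ≈⇒≐ T S T≈S = ⟦⟧-preserves T S T≈S , ⟦⟧-preserves S T (≐-sym T≈S)

  -- The pattern for the equational axioms: compute both sides as sets of assignments, then compare
  -- the sets.
  ≈-via : ∀ T S → ⟦ T ⟧ ≐ P → P ≐ Q → ⟦ S ⟧ ≐ Q → T ≈ S
  ≈-via T S T≐P P≐Q S≐Q = ≐⇒≈ T S (≐-trans T≐P (≐-trans P≐Q (≐-sym S≐Q)))

  -- Cylinders and diagonals as sets of assignments.

  Cyl : Var → Pred Tuple g → Pred Tuple g
  Cyl x P t = ∃[ s ] P s × (∀ y → y ≢ x → s y ≡ t y)

  Diag : Var → Var → Pred Tuple g
  Diag x y t = Is-just (t x) × t x ≡ t y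

  ∩-cong : P ≐ P₁ → Q ≐ Q₁ → (P ∩ Q) ≐ (P₁ ∩ Q₁)
  ∩-cong (P⊆ , ⊆P) (Q⊆ , ⊆Q) = (λ (u , v) → P⊆ u , Q⊆ v) , (λ (u , v) → ⊆P u , ⊆Q v)

  Cyl-mono : ∀ x → P ⊆ Q → Cyl x P ⊆ Cyl x Q
  Cyl-mono x P⊆Q (s , s∈P , s~t) = s , P⊆Q s∈P , s~t

  Cyl-cong : ∀ x → P ≐ Q → Cyl x P ≐ Cyl x Q
  Cyl-cong x (P⊆Q , Q⊆P) = Cyl-mono x P⊆Q , Cyl-mono x Q⊆P

  -- Agreement away from `x` is symmetric and transitive, so a witness for `Q` near `t` also serves
  -- near `s`, and conversely.
  Cyl-∩ : ∀ x → Cyl x (P ∩ Cyl x Q) ≐ (Cyl x P ∩ Cyl x Q)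
  Cyl-∩ x =
    (λ (s , (s∈P , r , r∈Q , r~s) , s~t) →
      (s , s∈P , s~t) , (r , r∈Q , λ y y≢x → trans (r~s y y≢x) (s~t y y≢x))) ,
    (λ ((s , s∈P , s~t) , (r , r∈Q , r~t)) →
      s , (s∈P , r , r∈Q , λ y y≢x → trans (r~t y y≢x) (sym (s~t y y≢x))) , s~t)

  Cyl-comm : ∀ x y → Cyl x (Cyl y P) ⊆ Cyl y (Cyl x P)
  Cyl-comm x y {t} (s , (r , r∈P , r~s) , s~t) =
    -- Make the two changes in the other order: the new intermediate tuple takes `y` from `r` and
    -- everything else from `t`, so it differs from `r` at most at `x`.
    t [ y ≔ r y ] , (r , r∈P , r~) , λ z z≢y → ≔-other t y (r y) z≢y
    where
    r~ : ∀ z → z ≢ x → r z ≡ (t [ y ≔ r y ]) z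
    r~ z z≢x with z ≟ y
    ... | yes refl = refl
    ... | no  z≢y  = trans (r~s z z≢y) (s~t z z≢x)

  Diag-sym : ∀ x y → Diag x y ⊆ Diag y x
  Diag-sym x y (tx , tx≡ty) = subst Is-just tx≡ty tx , sym tx≡ty

  Cyl-Diag : ∀ {x y z} → x ≢ y → x ≢ z → Diag y z ≐ Cyl x (Diag y x ∩ Diag x z)
  Cyl-Diag {x} {y} {z} x≢y x≢z = to , from
    where
    to : Diag y z ⊆ Cyl x (Diag y x ∩ Diag x z)
    to {t} (ty , ty≡tz) =
      -- Storing the common value of `y` and `z` at `x` leaves both of them intact, since `x`
      -- differs from each.
      t [ x ≔ t y ] ,
      ((subst Is-just (sym sy) ty , trans sy (sym sx)) ,
       (subst Is-just (sym sx) ty , trans sx (trans ty≡tz (sym sz)))) ,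
      λ w → ≔-other t x (t y)
      where
      sx = ≔-same t x (t y)
      sy = ≔-other t x (t y) (x≢y ∘ sym)
      sz = ≔-other t x (t y) (x≢z ∘ sym)
    from : Cyl x (Diag y x ∩ Diag x z) ⊆ Diag y z
    from (s , ((sy , sy≡sx) , (_ , sx≡sz)) , s~t) =
      subst Is-just (s~t y (x≢y ∘ sym)) sy ,
      trans (sym (s~t y (x≢y ∘ sym))) (trans (trans sy≡sx sx≡sz) (s~t z (x≢z ∘ sym)))

  -- A tuple on the diagonal is determined by its values away from x.
  Diag-Cyl-Diag : ∀ {x y} → x ≢ y → (∀ {s t} → s ≗ t → P s → P t) →
                  (Diag x y ∩ Cyl x (Diag x y ∩ P)) ⊆ P
  Diag-Cyl-Diag {x = x} {y} x≢y P-resp {t}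
    ((_ , tx≡ty) , s , ((_ , sx≡sy) , s∈P) , s~t) = P-resp s≗t s∈P
    where
    s≗t : s ≗ t
    s≗t z with z ≟ x
    ... | yes refl = trans sx≡sy (trans (s~t y (x≢y ∘ sym)) (sym tx≡ty))
    ... | no  z≢x  = s~t z z≢x

  -- Join, deletion and equality tables in terms of satisfaction.

  ⟦⋈⟧ : ∀ T S → ⟦ T ⋈ S ⟧ ≐ (⟦ T ⟧ ∩ ⟦ S ⟧)
  ⟦⋈⟧ T S = to , from
    where
    F = frame T ++ frame S
    nestedˡ : ∀ t → t ↾ F ↾ frame T ≗ t ↾ frame T
    nestedˡ t = ↾-↾ F (frame T) t ∈-++⁺ˡ
    nestedʳ : ∀ t → t ↾ F ↾ frame S ≗ t ↾ frame S
    nestedʳ t = ↾-↾ F (frame S) t (∈-++⁺ʳ (frame T))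
    to : ⟦ T ⋈ S ⟧ ⊆ (⟦ T ⟧ ∩ ⟦ S ⟧)
    to {t} (_ , t∈T , t∈S) =
      rows-resp T (nestedˡ t) t∈T , rows-resp S (nestedʳ t) t∈S
    from : (⟦ T ⟧ ∩ ⟦ S ⟧) ⊆ ⟦ T ⋈ S ⟧
    from {t} (t⊨T , t⊨S) =
      -- Satisfying a table forces definedness on its frame, so `t` is defined on the union of the
      -- frames.
      ↾∈G^ F t ([ frame-defined T t⊨T , frame-defined S t⊨S ]′ ∘ ∈-++⁻ (frame T)) ,
      rows-resp T (λ x → sym (nestedˡ t x)) t⊨T ,
      rows-resp S (λ x → sym (nestedʳ t x)) t⊨S

  ⟦del⟧ : ∀ x T → ⟦ del x T ⟧ ≐ Cyl x ⟦ T ⟧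
  ⟦del⟧ x T = to , from
    where
    F = frame T
    to : ⟦ del x T ⟧ ⊆ Cyl x ⟦ T ⟧
    to {t} (s , s∈T , t≗s) =
      -- Restoring the deleted entry of `s` gives agreement with `s` on the entire frame, because
      -- `t` already matches `s` on `F ∖ x`.
      t [ x ≔ s x ] , ⟦⟧-local T agree (rows⇒⟦⟧ T s∈T) , λ y → ≔-other t x (s x)
      where
      agree : ∀ {y} → y ∈ F → s y ≡ (t [ x ≔ s x ]) y
      agree {y} y∈F with y ≟ x
      ... | yes refl = refl
      ... | no  y≢x  = trans (sym (↾-∈ (F ∖ x) s y∈)) (trans (sym (t≗s y)) (↾-∈ (F ∖ x) t y∈))
        where y∈ = ∖-∈ F x y∈F y≢x
    from : Cyl x ⟦ T ⟧ ⊆ ⟦ del x T ⟧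
    from {t} (s , s⊨T , s~t) =
      s ↾ F , s⊨T , λ y →
        trans (↾-local (F ∖ x) (λ {z} z∈ → sym (s~t z (∖-≢ F x z∈))) y)
              (sym (↾-↾ F (F ∖ x) s (∖-⊆ F x) y))

  ⟦E⟧ : ∀ x y → ⟦ E x y ⟧ ≐ Diag x y
  ⟦E⟧ x y = to , from
    where
    F = x ∷ y ∷ []
    x∈ : x ∈ F
    x∈ = here refl
    y∈ : y ∈ F
    y∈ = there (here refl)
    to : ⟦ E x y ⟧ ⊆ Diag x y
    to {t} t⊨@(_ , tx≡ty) =
      frame-defined (E x y) t⊨ x∈ ,
      trans (sym (↾-∈ F t x∈)) (trans tx≡ty (↾-∈ F t y∈))
    from : Diag x y ⊆ ⟦ E x y ⟧
    from {t} (tx , tx≡ty) =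
      ↾∈G^ F t (λ { (here refl) → tx ; (there (here refl)) → subst Is-just tx≡ty tx }) ,
      trans (↾-∈ F t x∈) (trans tx≡ty (sym (↾-∈ F t y∈)))

  -- The order as inclusion, and how frames relate to `E x x` and `del x`.

  ≤⇒⊆ : ∀ T S → T ≤ S → ⟦ T ⟧ ⊆ ⟦ S ⟧
  ≤⇒⊆ T S T≤S t⊨T = proj₂ (proj₁ (⟦⋈⟧ T S) (proj₁ (≈⇒≐ T (T ⋈ S) T≤S) t⊨T))

  ⊆⇒≤ : ∀ T S → ⟦ T ⟧ ⊆ ⟦ S ⟧ → T ≤ S
  ⊆⇒≤ T S T⊆S =
    ≈-via T (T ⋈ S) ≐-refl ((λ t⊨T → t⊨T , T⊆S t⊨T) , proj₁) (⟦⋈⟧ T S)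

  defined⇒≤E : ∀ T x → (∀ {t} → ⟦ T ⟧ t → Is-just (t x)) → T ≤ E x x
  defined⇒≤E T x defined = ⊆⇒≤ T (E x x) λ t⊨T → proj₂ (⟦E⟧ x x) (defined t⊨T , refl)

  ≤E⇒defined : ∀ T x → T ≤ E x x → ∀ {t} → ⟦ T ⟧ t → Is-just (t x)
  ≤E⇒defined T x T≤E t⊨T = proj₁ (proj₁ (⟦E⟧ x x) (≤⇒⊆ T (E x x) T≤E t⊨T))

  ∈frame⇒≤E : ∀ T x → x ∈ frame T → T ≤ E x x
  ∈frame⇒≤E T x x∈F = defined⇒≤E T x λ t⊨T → frame-defined T t⊨T x∈F

  -- Satisfaction of `T` does not depend on a variable outside its frame, so cylindrifying along it
  -- adds nothing.
  ∉frame⇒≈del : ∀ T x → ¬ (x ∈ frame T) → T ≈ del x T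
  ∉frame⇒≈del T x x∉F = ≈-via T (del x T) ≐-refl (to , from) (⟦del⟧ x T)
    where
    to : ⟦ T ⟧ ⊆ Cyl x ⟦ T ⟧
    to {t} t⊨T = t , t⊨T , λ _ _ → refl
    from : Cyl x ⟦ T ⟧ ⊆ ⟦ T ⟧
    from (s , s⊨T , s~t) =
      ⟦⟧-local T (λ {y} y∈F → s~t y λ y≡x → x∉F (subst (_∈ frame T) y≡x y∈F)) s⊨T

  -- Erase `x` from a row: the result satisfies `del x T`, but not `T`, whose satisfying assignments
  -- are all defined at `x`.
  ≤E⇒≉del : ∀ T x → Satisfiable (rows T) → T ≤ E x x → ¬ (T ≈ del x T)
  ≤E⇒≉del T x (t , t∈T) T≤E T≈del
    with () ← subst Is-just (≔-same t x nothing) (≤E⇒defined T x T≤E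
      (proj₂ (≈⇒≐ T (del x T) T≈del) (proj₂ (⟦del⟧ x T)
        (t , rows⇒⟦⟧ T t∈T , λ y y≢x → sym (≔-other t x nothing y≢x)))))

  empty⇒≈∅ : ∀ T → Empty (rows T) → T ≈ ∅
  empty⇒≈∅ T empty = (λ {t} t∈T → ⊥-elim (empty t t∈T)) , λ ()

  -- Schemas, with a case split on whether a table is empty.

  module _ (em : ExcludedMiddle g) where

    ≉∅⇒satisfiable : ∀ T → ¬ (T ≈ ∅) → Satisfiable (rows T)
    ≉∅⇒satisfiable T T≉∅ =
      decidable-stable em λ ¬sat → T≉∅ (empty⇒≈∅ T λ t t∈T → ¬sat (t , t∈T))

    -- For a nonempty table, the domain of any single row is the frame. The empty table lies below
    -- every `E x x`, which matches the convention that its schema is all of `Var`.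
    schema≐≤E : ∀ T → schema T ≐ (λ x → T ≤ E x x)
    schema≐≤E T = to , from
      where
      to : ∀ {x} → schema T x → T ≤ E x x
      to {x} (inj₁ (_ , x∈F)) = ∈frame⇒≤E T x x∈F
      to {x} (inj₂ empty)     = defined⇒≤E T x λ t⊨T → ⊥-elim (empty _ t⊨T)
      from : ∀ {x} → T ≤ E x x → schema T x
      from {x} T≤E with em {Satisfiable (rows T)}
      ... | yes sat@(t , t∈T) =
        inj₁ (sat , proj₁ (rows⊆G^ T t∈T) (≤E⇒defined T x T≤E (rows⇒⟦⟧ T t∈T)))
      ... | no  ¬sat = inj₂ λ t t∈T → ¬sat (t , t∈T)

    schema-mono : ∀ T S → ⟦ S ⟧ ⊆ ⟦ T ⟧ → schema T ⊆ schema S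
    schema-mono T S S⊆T {x} x∈ = proj₂ (schema≐≤E S)
      (defined⇒≤E S x λ t⊨S → ≤E⇒defined T x (proj₁ (schema≐≤E T) x∈) (S⊆T t⊨S))

    schema-empty : ∀ T → Empty (schema T) → T ≈ [⟨⟩]
    schema-empty T ∉schema with em {Satisfiable (rows T)}
    ... | yes sat@(_ , r∈T) = ≐⇒≈ T [⟨⟩]
      ( (λ _ _ → refl)
      , (λ _ → ⟦⟧-local T (λ {x} x∈F → ⊥-elim (∉schema x (inj₁ (sat , x∈F))))
                 (rows⇒⟦⟧ T r∈T)))
    ... | no ¬sat =
      -- An empty table has every variable in its schema, and the preimage of `0` is one.
      ⊥-elim (∉schema (Bijection.to⁻ countable 0) (inj₂ λ t t∈T → ¬sat (t , t∈T)))

    -- Verification of the axioms in the full table algebra.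

    Tab-isProjectionalSemilattice : G → IsProjectionalSemilattice (Tab countable G)
    Tab-isProjectionalSemilattice point = record
      { c-cong   = λ x {T} {S} T≈S →
          ≈-via (del x T) (del x S) (⟦del⟧ x T) (Cyl-cong x (≈⇒≐ T S T≈S)) (⟦del⟧ x S)
      ; dom-cong = λ {T} {S} T≈S →
          schema-mono T S (⟦⟧-preserves S T (≐-sym T≈S)) ,
          schema-mono S T (⟦⟧-preserves T S T≈S)
      ; ps0-semilattice = record
        { isBand = record
          { isSemigroup = record
            { isMagma = record
              { isEquivalence = record { refl = ≐-refl ; sym = ≐-sym ; trans = ≐-trans }
              ; ∙-cong = λ {T} {T₁} {S} {S₁} T≈T₁ S≈S₁ →
                  ≈-via (T ⋈ S) (T₁ ⋈ S₁) (⟦⋈⟧ T S)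
                    (∩-cong (≈⇒≐ T T₁ T≈T₁) (≈⇒≐ S S₁ S≈S₁)) (⟦⋈⟧ T₁ S₁)
              }
            ; assoc = λ T S R →
                ≈-via ((T ⋈ S) ⋈ R) (T ⋈ (S ⋈ R))
                  (≐-trans (⟦⋈⟧ (T ⋈ S) R) (∩-cong (⟦⋈⟧ T S) ≐-refl))
                  ((λ ((u , v) , w) → u , (v , w)) , (λ (u , (v , w)) → (u , v) , w))
                  (≐-trans (⟦⋈⟧ T (S ⋈ R)) (∩-cong ≐-refl (⟦⋈⟧ S R)))
            }
          ; idem = λ T → ≈-via (T ⋈ T) T (⟦⋈⟧ T T) (proj₁ , λ u → u , u) ≐-refl
          }
        ; comm = λ T S →
            ≈-via (T ⋈ S) (S ⋈ T) (⟦⋈⟧ T S)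
              ((λ (u , v) → v , u) , (λ (u , v) → v , u)) (⟦⋈⟧ S T)
        }
      ; ps0-least    = λ T → ⊆⇒≤ ∅ T λ ()
      ; ps0-greatest = λ T → ⊆⇒≤ T [⟨⟩] λ _ _ → refl
      ; ps1  = λ x → empty⇒≈∅ (del x ∅) λ _ ()
      ; ps2  = λ x T → ⊆⇒≤ T (del x T) λ {t} t⊨T →
          proj₂ (⟦del⟧ x T) (t , t⊨T , λ _ _ → refl)
      ; ps3  = λ x T S →
          ≈-via (del x (T ⋈ del x S)) (del x T ⋈ del x S)
            (≐-trans (⟦del⟧ x (T ⋈ del x S)) (Cyl-cong x
              (≐-trans (⟦⋈⟧ T (del x S)) (∩-cong ≐-refl (⟦del⟧ x S)))))
            (Cyl-∩ x)
            (≐-trans (⟦⋈⟧ (del x T) (del x S)) (∩-cong (⟦del⟧ x T) (⟦del⟧ x S)))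
      ; ps4  = λ x y T →
          ≈-via (del x (del y T)) (del y (del x T))
            (≐-trans (⟦del⟧ x (del y T)) (Cyl-cong x (⟦del⟧ y T)))
            (Cyl-comm x y , Cyl-comm y x)
            (≐-trans (⟦del⟧ y (del x T)) (Cyl-cong y (⟦del⟧ x T)))
      ; ps5  = λ x T T≉∅ → mk⇔
          (λ T≉del → ∈frame⇒≤E T x (decidable-stable (x ∈? frame T)
            (T≉del ∘ ∉frame⇒≈del T x)))
          (≤E⇒≉del T x (≉∅⇒satisfiable T T≉∅))
      ; ps6  = λ x y z x≢y x≢z →
          ≈-via (E y z) (del x (E y x ⋈ E x z)) (⟦E⟧ y z) (Cyl-Diag x≢y x≢z)
            (≐-trans (⟦del⟧ x (E y x ⋈ E x z)) (Cyl-cong x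
              (≐-trans (⟦⋈⟧ (E y x) (E x z)) (∩-cong (⟦E⟧ y x) (⟦E⟧ x z)))))
      ; ps7  = λ x y T x≢y →
          ⊆⇒≤ (E x y ⋈ del x (E x y ⋈ T)) T λ t⊨ →
            Diag-Cyl-Diag x≢y (λ s≗t → ⟦⟧-local T (λ {z} _ → s≗t z))
              (proj₁ (≐-trans (⟦⋈⟧ (E x y) (del x (E x y ⋈ T))) (∩-cong (⟦E⟧ x y)
                (≐-trans (⟦del⟧ x (E x y ⋈ T)) (Cyl-cong x
                  (≐-trans (⟦⋈⟧ (E x y) T) (∩-cong (⟦E⟧ x y) ≐-refl)))))) t⊨)
      ; ps8  = λ T T≉∅ → let sat = ≉∅⇒satisfiable T T≉∅ in
          frame T ,
          [ proj₂ , (λ empty → ⊥-elim (empty _ (proj₂ sat))) ]′ ,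
          λ x∈F → inj₁ (sat , x∈F)
      ; ps9  = schema≐≤E
      ; ps10 = schema-empty
      -- The constant assignment at `point` lies on the diagonal. Over an empty `G` the table
      -- `E x x` would have no rows, so here an element of `G` is essential.
      ; ps11 = λ x E≈∅ → ⊥-elim (lower
          (proj₁ (≈⇒≐ (E x x) ∅ E≈∅) {λ _ → just point}
            (proj₂ (⟦E⟧ x x) (just tt , refl))))
      ; ps12 = λ x y →
          ≈-via (E x y) (E y x) (⟦E⟧ x y) (Diag-sym x y , Diag-sym y x) (⟦E⟧ y x)
      }

theorem1 : ∀ {g a} → ExcludedMiddle g →
    {Var : Set} (countable : Var ⤖ ℕ) (G : Set g) → G →
    (A : Pred (Tables.Table countable G) a) (sub : IsSubuniverse (Tab countable G) A) →
    IsProjectionalSemilattice (subalgebra (Tab countable G) A sub)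
theorem1 em countable G point A sub =
  subalgebra-isProjectionalSemilattice (Tab countable G) A sub
    (Tab-isProjectionalSemilattice countable G em point)
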